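{- Let $x,y$ be integers with $x\ge 0$ and $M(x,y)\ne\emptyset$, and let $G_0$ be a minimal graph in $M(x,y)$. If $G_0$ is nonseparable, then (a) $|V(G_0)|=4f(G_0)-2x-1$; (b) $4f(G_0)-2x-1<R(f(G_0)-x+1,3)$.
   Context: All graphs are finite, simple and undirected (the graph with empty vertex set is allowed). $\chi(G)$ is the chromatic number, $\omega(G)$ the clique number, $\alpha(G)$ the independence number, and $f(G)=\chi(G)-\omega(G)$. For integers $x,y$, $M(x,y)$ is the set of graphs $G$ with $|V(G)|<\chi(G)+2f(G)-x$ and $f(G)\le y$. For a nonempty set $\mathcal M$ of graphs, a minimal graph in $\mathcal M$ is a $G_0\in\mathcal M$ with $|V(G_0)|=\min\{|V(G)|:G\in\mathcal M\}$. For vertex-disjoint graphs $G_1,G_2$, $G_1+G_2$ is their join (the union together with all edges between $V(G_1)$ and $V(G_2)$). A graph $G$ is separable if $G=G_1+G_2$ with $V(G_1)\ne\emptyset$ and $V(G_2)\ne\emptyset$; otherwise nonseparable. $R(p,3)$ is the smallest $n$ such that every graph on at least $n$ vertices has $\omega(G)\ge p$ or $\alpha(G)\ge 3$. -}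

module Defs where

open import Data.Nat using (ℕ; _≤_)
open import Data.Integer as ℤ using (ℤ; +_)
open import Data.Fin using (Fin)
open import Data.Bool using (Bool; true; false)
open import Data.Product using (Σ; ∃; _×_; _,_)
open import Data.Sum using (_⊎_)
open import Relation.Binary.PropositionalEquality using (_≡_; _≢_)

record Graph (n : ℕ) : Set where
  field
    adj   : Fin n → Fin n → Bool
    sym   : ∀ i j → adj i j ≡ adj j i
    irrefl : ∀ i → adj i i ≡ false
open Graph public

order : ∀ {n} → Graph n → ℕ
order {n} _ = n

Colorable : ∀ {n} → Graph n → ℕ → Set
Colorable {n} G k =
  Σ (Fin n → Fin k) λ c → ∀ i j → adj G i j ≡ true → c i ≢ c j

HasClique : ∀ {n} → Graph n → ℕ → Set
HasClique {n} G k =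
  Σ (Fin k → Fin n) λ v → ∀ a b → a ≢ b → adj G (v a) (v b) ≡ true

HasIndep : ∀ {n} → Graph n → ℕ → Set
HasIndep {n} G k =
  Σ (Fin k → Fin n) λ v →
    (∀ a b → a ≢ b → v a ≢ v b) × (∀ a b → adj G (v a) (v b) ≡ false)

IsChi : ∀ {n} → Graph n → ℕ → Set
IsChi G c = Colorable G c × (∀ k → Colorable G k → c ≤ k)

IsOmega : ∀ {n} → Graph n → ℕ → Set
IsOmega G w = HasClique G w × (∀ k → HasClique G k → k ≤ w)

IsAlpha : ∀ {n} → Graph n → ℕ → Set
IsAlpha G a = HasIndep G a × (∀ k → HasIndep G k → k ≤ a)

InM : ℤ → ℤ → ∀ {n} → Graph n → Set
InM x y {n} G = ∃ λ c → ∃ λ w → IsChi G c × IsOmega G w ×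
  (let f = + c ℤ.- + w in
     ((+ n) ℤ.< (+ c) ℤ.+ (+ 2) ℤ.* f ℤ.- x) × (f ℤ.≤ y))

IsMinimalIn : ℤ → ℤ → ∀ {n} → Graph n → Set
IsMinimalIn x y {n} G =
  InM x y G × (∀ m (H : Graph m) → InM x y H → n ≤ m)

-- G = G₁ + G₂ with both parts nonempty: the vertex set splits into two
-- nonempty classes (A = true, B = false) with every A–B pair adjacent
-- (G₁, G₂ being the induced subgraphs on the two classes).
Separable : ∀ {n} → Graph n → Set
Separable {n} G = Σ (Fin n → Bool) λ A →
  (∃ λ i → A i ≡ true) × (∃ λ j → A j ≡ false) ×
  (∀ i j → A i ≡ true → A j ≡ false → adj G i j ≡ true)

Nonseparable : ∀ {n} → Graph n → Set
Nonseparable G = Separable G → ⊥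
  where open import Data.Empty using (⊥)

RamseyProp : ℤ → ℕ → Set
RamseyProp p r = ∀ m → r ≤ m → (H : Graph m) → ∀ w a →
  IsOmega H w → IsAlpha H a → (p ℤ.≤ + w) ⊎ (3 ≤ a)

IsR3 : ℤ → ℕ → Set
IsR3 p r = RamseyProp p r × (∀ r' → RamseyProp p r' → r ≤ r')

{-# OPTIONS --safe #-}
-- Write f = χ − ω.  Deleting a vertex changes f by at most 1 and never increases
-- |V| − χ, so by minimality every proper induced subgraph of G₀ has smaller f.
-- Deleting an independent set S therefore lowers χ by exactly 1 and keeps ω, and
-- minimality yields |V| ≥ χ + 2f − x − 3 + |S|.  As |V| ≤ χ + 2f − x − 1, this gives
-- α ≤ 2, and S of size 2 gives |V| = χ + 2f − x − 1.  Since α ≤ 2, colourings are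
-- matchings of the complement; the complement is connected and each vertex is missed
-- by a maximum matching, so Gallai's lemma gives |V| = 2χ − 1.  These two equations
-- yield (a), and ω = f − x together with α ≤ 2 yields (b).
module Submission where

open import Defs renaming (sym to adj-sym)
import Algebra.Properties.CommutativeMonoid.Sum
open import Data.Bool as Bool using (true; false)
open import Data.Bool.Properties using (¬-not)
open import Data.Empty using (⊥; ⊥-elim)
open import Data.Fin as Fin using (Fin; zero; suc; punchIn; punchOut; inject≤)
open import Data.Fin.Permutation
  using (Permutation′; permutation; transpose; _⟨$⟩ʳ_; _⟨$⟩ˡ_; inverseˡ; inverseʳ)
open import Data.Fin.Properties as Finₚ using
  (_≟_; any?; all?; suc-injective; injective⇒≤; punchIn-punchOut; punchOut-injective
  ; inject≤-injective)
open import Data.Integer as ℤ using (ℤ; +_; _+_; _-_; -_; _*_; _≤_; _<_)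
import Data.Integer.Properties as ℤₚ
import Data.Integer.Tactic.RingSolver as ℤ-Solver
open import Data.List using ([]; _∷_)
open import Data.Nat as ℕ using (ℕ; zero; suc; z≤n; s≤s)
open import Data.Nat.Induction using (<-wellFounded)
import Data.Nat.Properties as ℕₚ
open import Data.Nat.Tactic.RingSolver using (solve)
open import Data.Product using (∃; _×_; _,_; proj₁; proj₂)
open import Data.Sum using (_⊎_; inj₁; inj₂)
open import Data.Vec.Functional using () renaming (_∷_ to _◂_)
open import Function using (_∘_; id; Injective)
open import Induction.WellFounded using (Acc; acc)
open import Relation.Binary.PropositionalEquality
open import Relation.Nullary
open import Relation.Nullary.Decidable
  using (dec-true; dec-false; map′; decidable-stable; ¬?; _×-dec_; _⊎-dec_; _→-dec_)
open import Relation.Unary using (Decidable)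

open Algebra.Properties.CommutativeMonoid.Sum ℕₚ.+-0-commutativeMonoid
  using (sum; sum-permute; sum-cong-≗; ∑-distrib-+)

private variable
  m n k : ℕ

-- Decidable search

does-true : {A : Set} (a? : Dec A) → does a? ≡ true → A
does-true (yes a) _ = a

does-false : {A : Set} (a? : Dec A) → does a? ≡ false → ¬ A
does-false (no ¬a) _ = ¬a

-- Values are chosen one argument at a time. The function built this way agrees with a given witness
-- only pointwise, so `resp` stands in for extensionality.
any-function? : (P : (Fin n → Fin k) → Set) →
  (∀ {f g} → f ≗ g → P f → P g) → Decidable P → Dec (∃ P)
any-function? {zero} P resp P? =
  map′ (λ p → _ , p) (λ (_ , p) → resp (λ ()) p) (P? λ ())
any-function? {suc n} P resp P? =
  map′ (λ (a , f , p) → a ◂ f , p)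
       (λ (f , p) → f zero , f ∘ suc , resp (λ { zero → refl ; (suc _) → refl }) p)
       (any? λ a → any-function? (λ f → P (a ◂ f))
         (λ f≗g → resp λ { zero → refl ; (suc i) → f≗g i }) (λ f → P? (a ◂ f)))

least : {P : ℕ → Set} → Decidable P → ∀ b → P b →
  ∃ λ k → P k × (∀ j → P j → k ℕ.≤ j)
least P? b pb with P? 0
... | yes p₀ = 0 , p₀ , λ _ _ → z≤n
least P? zero pb | no ¬p₀ = contradiction pb ¬p₀
least P? (suc b) pb | no ¬p₀ with least (P? ∘ suc) b pb
... | k , pk , min = suc k , pk , λ where
  zero    p₀ → contradiction p₀ ¬p₀
  (suc j) pj → s≤s (min j pj)

greatest : {P : ℕ → Set} → Decidable P → ∀ b → P 0 → (∀ j → P j → j ℕ.≤ b) →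
  ∃ λ k → P k × (∀ j → P j → j ℕ.≤ k)
greatest P? b p₀ ub with P? b
... | yes pb = b , pb , ub
greatest P? zero p₀ ub | no ¬p = contradiction p₀ ¬p
greatest P? (suc b) p₀ ub | no ¬p =
  greatest P? b p₀ λ j pj → ℕ.s≤s⁻¹ (ℕₚ.≤∧≢⇒< (ub j pj) λ { refl → ¬p pj })

-- Counting

𝟙 : {A : Set} → Dec A → ℕ
𝟙 (yes _) = 1
𝟙 (no _)  = 0

𝟙-mono : {A B : Set} (a? : Dec A) (b? : Dec B) → (A → B) → 𝟙 a? ℕ.≤ 𝟙 b?
𝟙-mono (no _)  _       _ = z≤n
𝟙-mono (yes _) (yes _) _ = ℕₚ.≤-refl
𝟙-mono (yes a) (no ¬b) f = contradiction (f a) ¬b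

count : {P : Fin n → Set} → Decidable P → ℕ
count P? = sum λ i → 𝟙 (P? i)

count-mono : {P Q : Fin n → Set} (P? : Decidable P) (Q? : Decidable Q) →
  (∀ i → P i → Q i) → count P? ℕ.≤ count Q?
count-mono {zero}  P? Q? P⊆Q = z≤n
count-mono {suc n} P? Q? P⊆Q =
  ℕₚ.+-mono-≤ (𝟙-mono (P? zero) (Q? zero) (P⊆Q zero))
              (count-mono (P? ∘ suc) (Q? ∘ suc) (P⊆Q ∘ suc))

count-mono-< : {P Q : Fin n → Set} (P? : Decidable P) (Q? : Decidable Q) →
  (∀ i → P i → Q i) → ∀ j → Q j → ¬ P j → count P? ℕ.< count Q?
count-mono-< P? Q? P⊆Q zero q ¬p with P? zero | Q? zero
... | yes p | _     = contradiction p ¬p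
... | no _  | no ¬q = contradiction q ¬q
... | no _  | yes _ = s≤s (count-mono (P? ∘ suc) (Q? ∘ suc) (P⊆Q ∘ suc))
count-mono-< P? Q? P⊆Q (suc j) q ¬p =
  ℕₚ.+-mono-≤-< (𝟙-mono (P? zero) (Q? zero) (P⊆Q zero))
                (count-mono-< (P? ∘ suc) (Q? ∘ suc) (P⊆Q ∘ suc) j q ¬p)

-- Transpositions and fixed points

transpose-left : (i j : Fin n) → transpose i j ⟨$⟩ʳ i ≡ j
transpose-left i j rewrite dec-true (i ≟ i) refl = refl

transpose-right : (i j : Fin n) → transpose i j ⟨$⟩ʳ j ≡ i
transpose-right i j with j ≟ i
... | yes j≡i = j≡i
... | no _ rewrite dec-true (j ≟ j) refl = refl

transpose-other : (i j : Fin n) {l : Fin n} → l ≢ i → l ≢ j → transpose i j ⟨$⟩ʳ l ≡ l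
transpose-other i j {l} l≢i l≢j
  rewrite dec-false (l ≟ i) l≢i | dec-false (l ≟ j) l≢j = refl

fixed? : (σ : Fin n → Fin n) → Decidable λ i → σ i ≡ i
fixed? σ i = σ i ≟ i

fixes : (Fin n → Fin n) → ℕ
fixes σ = count (fixed? σ)

fixes-cong : {σ τ : Fin n → Fin n} → σ ≗ τ → fixes σ ℕ.≤ fixes τ
fixes-cong {σ = σ} {τ} σ≗τ =
  count-mono (fixed? σ) (fixed? τ) λ i p → trans (sym (σ≗τ i)) p

conjugate : Permutation′ n → (Fin n → Fin n) → Fin n → Fin n
conjugate π σ i = π ⟨$⟩ʳ (σ (π ⟨$⟩ˡ i))

fixes-conjugate : (π : Permutation′ n) (σ : Fin n → Fin n) →
  fixes (conjugate π σ) ℕ.≤ fixes σ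
fixes-conjugate π σ = begin
  fixes (conjugate π σ)                         ≡⟨ sum-permute _ π ⟩
  count (λ i → fixed? (conjugate π σ) (π ⟨$⟩ʳ i)) ≤⟨ count-mono _ (fixed? σ) fixed ⟩
  fixes σ                                       ∎
  where
  open ℕₚ.≤-Reasoning
  fixed : ∀ i → conjugate π σ (π ⟨$⟩ʳ i) ≡ π ⟨$⟩ʳ i → σ i ≡ i
  fixed i p = trans (cong σ (sym (inverseˡ π)))
    (trans (sym (inverseˡ π)) (trans (cong (π ⟨$⟩ˡ_) p) (inverseˡ π)))

-- Gallai's lemma

-- A matching of the complement of G, as the involution exchanging matched
-- vertices; its fixed points are the vertices it misses.
record Matching (G : Graph n) (σ : Fin n → Fin n) : Set where
  field
    involutive  : ∀ i → σ (σ i) ≡ i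
    nonadjacent : ∀ i → adj G i (σ i) ≡ false

  flip : ∀ {i j} → σ i ≡ j → σ j ≡ i
  flip refl = involutive _
open Matching

matching? : (G : Graph n) → Decidable (Matching G)
matching? G σ =
  map′ (λ (p , q) → record { involutive = p ; nonadjacent = q })
       (λ M → involutive M , nonadjacent M)
       (all? (λ i → σ (σ i) ≟ i) ×-dec all? (λ i → adj G i (σ i) Bool.≟ false))

matching-cong : (G : Graph n) {σ τ : Fin n → Fin n} → σ ≗ τ → Matching G σ → Matching G τ
matching-cong G {σ} {τ} σ≗τ M = record
  { involutive  = λ i → trans (sym (trans (cong σ (σ≗τ i)) (σ≗τ (τ i)))) (involutive M i)
  ; nonadjacent = λ i → trans (cong (adj G i) (sym (σ≗τ i))) (nonadjacent M i) }

-- An involution fixing `u` and `v` sends no other vertex to them, so the transposition acts only at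
-- `u` and `v`, where it joins the two missed vertices.
addPair : (G : Graph n) {σ : Fin n → Fin n} {u v : Fin n} → Matching G σ →
  σ u ≡ u → σ v ≡ v → adj G u v ≡ false → Matching G (λ i → transpose u v ⟨$⟩ʳ σ i)
addPair G {σ} {u} {v} M σu σv uv = record { involutive = inv ; nonadjacent = non }
  where
  τ : Fin _ → Fin _
  τ i = transpose u v ⟨$⟩ʳ σ i
  τu : τ u ≡ v
  τu = trans (cong (transpose u v ⟨$⟩ʳ_) σu) (transpose-left u v)
  τv : τ v ≡ u
  τv = trans (cong (transpose u v ⟨$⟩ʳ_) σv) (transpose-right u v)
  avoids : ∀ {i j} → σ j ≡ j → i ≢ j → σ i ≢ j
  avoids σj i≢j σi = i≢j (trans (sym (flip M σi)) σj)
  τi : ∀ {i} → i ≢ u → i ≢ v → τ i ≡ σ i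
  τi i≢u i≢v = transpose-other u v (avoids σu i≢u) (avoids σv i≢v)
  inv : ∀ i → τ (τ i) ≡ i
  inv i with i ≟ u | i ≟ v
  ... | yes refl | _ = trans (cong τ τu) τv
  ... | no _ | yes refl = trans (cong τ τv) τu
  ... | no i≢u | no i≢v = trans (cong τ (τi i≢u i≢v))
    (trans (τi (avoids σu i≢u) (avoids σv i≢v)) (involutive M i))
  non : ∀ i → adj G i (τ i) ≡ false
  non i with i ≟ u | i ≟ v
  ... | yes refl | _ = trans (cong (adj G u) τu) uv
  ... | no _ | yes refl = trans (cong (adj G v) τv) (trans (adj-sym G v u) uv)
  ... | no i≢u | no i≢v = trans (cong (adj G i) (τi i≢u i≢v)) (nonadjacent M i)

module _ (G : Graph n) (d : ℕ) (maximum : ∀ σ → Matching G σ → d ℕ.≤ fixes σ) where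

  -- By `maximum` every matching misses at least `d` vertices, so `fixes σ ≤ d` says that `σ` is a
  -- maximum matching.
  MissedTogether : Fin n → Fin n → Set
  MissedTogether u v = ∃ λ σ → Matching G σ × fixes σ ℕ.≤ d × σ u ≡ u × σ v ≡ v

  missedTogether? : ∀ u v → Dec (MissedTogether u v)
  missedTogether? u v = any-function? _
    (λ f≗g (M , le , fu , fv) → matching-cong G f≗g M ,
      ℕₚ.≤-trans (fixes-cong (sym ∘ f≗g)) le , trans (sym (f≗g u)) fu , trans (sym (f≗g v)) fv)
    (λ σ → matching? G σ ×-dec (fixes σ ℕ.≤? d) ×-dec (σ u ≟ u) ×-dec (σ v ≟ v))

  -- Were `u` and `v` nonadjacent, `addPair` would give a matching missing fewer vertices than a
  -- maximum one.
  missedTogether⇒adjacent : ∀ {u v} → u ≢ v → MissedTogether u v → adj G u v ≡ true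
  missedTogether⇒adjacent {u} {v} u≢v (σ , M , le , σu , σv) = ¬-not λ uv →
    ℕₚ.<-irrefl refl (begin-strict
      d        ≤⟨ maximum τ (addPair G M σu σv uv) ⟩
      fixes τ  <⟨ count-mono-< (fixed? τ) (fixed? σ) still u σu moved ⟩
      fixes σ  ≤⟨ le ⟩
      d        ∎)
    where
    open ℕₚ.≤-Reasoning
    τ : Fin n → Fin n
    τ i = transpose u v ⟨$⟩ʳ σ i
    moved : τ u ≢ u
    moved p = u≢v (trans (sym p) (trans (cong (transpose u v ⟨$⟩ʳ_) σu) (transpose-left u v)))
    still : ∀ i → τ i ≡ i → σ i ≡ i
    still i p with i ≟ u | i ≟ v
    ... | yes refl | _        = σu
    ... | no _     | yes refl = σv
    ... | no i≢u   | no i≢v   = trans (sym (transpose-other u v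
      (λ q → i≢u (trans (sym (flip M q)) σu)) (λ q → i≢v (trans (sym (flip M q)) σv)))) p

  disagree? : (σ τ : Fin n → Fin n) → Decidable λ i → σ i ≢ τ i
  disagree? σ τ i = ¬? (σ i ≟ τ i)

  -- The pair of `M` at a vertex `x` missed by `N` but not by `M` is forced into `N`, at the cost of
  -- the pair that `N` has at `M x`. The hypotheses on `u`, `v` and `w` yield such an `x` other than
  -- `w`.
  exchange : ∀ {u v w} {M N : Fin n → Fin n} →
    ¬ MissedTogether u w → ¬ MissedTogether v w → u ≢ v →
    Matching G M → fixes M ℕ.≤ d → M u ≡ u → M v ≡ v →
    Matching G N → fixes N ℕ.≤ d → N w ≡ w →
    ∃ λ N′ → Matching G N′ × fixes N′ ℕ.≤ d × N′ w ≡ w ×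
      count (disagree? M N′) ℕ.< count (disagree? M N)
  exchange {u} {v} {w} {M} {N} ¬uw ¬vw u≢v isM M≤d Mu Mv isN N≤d Nw
    with any? (λ x → ¬? (x ≟ w) ×-dec (N x ≟ x) ×-dec ¬? (M x ≟ x))
  -- Here `N` misses neither `u` nor `v`, and all it misses except `w` is missed by `M`. Sending `w`
  -- to `u` injects its missed vertices into those of `M` without reaching `v`, so `N` would miss
  -- fewer than `d`.
  ... | no none = contradiction (maximum N isN) (ℕₚ.<⇒≱ (begin-strict
      fixes N                                       ≡⟨ sum-permute _ (transpose u w) ⟩
      count (λ i → fixed? N (transpose u w ⟨$⟩ʳ i)) <⟨ count-mono-< _ (fixed? M) N⊆M v Mv v-moved ⟩
      fixes M                                       ≤⟨ M≤d ⟩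
      d                                             ∎))
    where
    open ℕₚ.≤-Reasoning
    Nu : N u ≢ u
    Nu p = ¬uw (N , isN , N≤d , p , Nw)
    Nv : N v ≢ v
    Nv p = ¬vw (N , isN , N≤d , p , Nw)
    v≢w : v ≢ w
    v≢w refl = Nv Nw
    v-moved : N (transpose u w ⟨$⟩ʳ v) ≢ transpose u w ⟨$⟩ʳ v
    v-moved p = Nv (subst (λ i → N i ≡ i) (transpose-other u w (u≢v ∘ sym) v≢w) p)
    -- Up to exchanging u and w, the vertices missed by N are missed by M.
    N⊆M : ∀ i → N (transpose u w ⟨$⟩ʳ i) ≡ transpose u w ⟨$⟩ʳ i → M i ≡ i
    N⊆M i p = case (i ≟ u) (i ≟ w) (M i ≟ i)
      where
      case : Dec (i ≡ u) → Dec (i ≡ w) → Dec (M i ≡ i) → M i ≡ i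
      case _ _ (yes Mi) = Mi
      case (yes refl) _ _ = Mu
      case (no _) (yes refl) _ =
        contradiction (subst (λ i → N i ≡ i) (transpose-right u w) p) Nu
      case (no i≢u) (no i≢w) (no ¬Mi) = contradiction
        (i , i≢w , subst (λ i → N i ≡ i) (transpose-other u w i≢u i≢w) p , ¬Mi) none
  -- Conjugating by the transposition of `x` and `z` replaces the pair `y`, `z` of `N` by the pair
  -- `x`, `y` of `M` and misses `z` instead of `x`. At `x` the new matching agrees with `M`, while
  -- `N` did not.
  ... | yes (x , x≢w , Nx , ¬Mx) =
    N′ , record { involutive = inv ; nonadjacent = non } ,
    ℕₚ.≤-trans (fixes-conjugate (transpose x z) N) N≤d , N′w ,
    count-mono-< (disagree? M N′) (disagree? M N) agree x
      (λ p → ¬Mx (trans p Nx)) (λ p → p (sym N′x))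
    where
    y z : Fin n
    y = M x
    z = N y
    N′ : Fin n → Fin n
    N′ = conjugate (transpose x z) N
    Mxy : adj G x y ≡ false
    Mxy = nonadjacent isM x
    My : M y ≡ x
    My = involutive isM x
    -- If `N` missed both `x` and `y` they would be adjacent, but `M` pairs them.
    Ny : N y ≢ y
    Ny p with trans (sym Mxy) (missedTogether⇒adjacent (¬Mx ∘ sym) (N , isN , N≤d , Nx , p))
    ... | ()
    Nz : N z ≡ y
    Nz = involutive isN y
    z≢x : z ≢ x
    z≢x p = ¬Mx (trans (sym Nz) (trans (cong N p) Nx))
    z≢y : z ≢ y
    z≢y = Ny
    w≢z : w ≢ z
    w≢z p = z≢y (trans (sym (trans (cong N (sym p)) (trans Nw p))) Nz)
    N′x : N′ x ≡ y
    N′x = trans (cong (λ i → transpose x z ⟨$⟩ʳ N i) (transpose-right z x))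
      (trans (cong (transpose x z ⟨$⟩ʳ_) Nz) (transpose-other x z ¬Mx (z≢y ∘ sym)))
    N′z : N′ z ≡ z
    N′z = trans (cong (λ i → transpose x z ⟨$⟩ʳ N i) (transpose-left z x))
      (trans (cong (transpose x z ⟨$⟩ʳ_) Nx) (transpose-left x z))
    N′y : N′ y ≡ x
    N′y = trans (cong (λ i → transpose x z ⟨$⟩ʳ N i) (transpose-other z x (z≢y ∘ sym) ¬Mx))
      (transpose-right x z)
    N′i : ∀ {i} → i ≢ x → i ≢ y → i ≢ z → N′ i ≡ N i
    N′i {i} i≢x i≢y i≢z =
      trans (cong (λ i → transpose x z ⟨$⟩ʳ N i) (transpose-other z x i≢z i≢x))
        (transpose-other x z (λ p → i≢x (trans (sym (flip isN p)) Nx))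
          (λ p → i≢y (trans (sym (flip isN p)) Nz)))
    N′w : N′ w ≡ w
    N′w = trans (N′i (x≢w ∘ sym) (λ { refl → Ny Nw }) w≢z) Nw
    inv : ∀ i → N′ (N′ i) ≡ i
    inv i = trans (cong (λ j → transpose x z ⟨$⟩ʳ N j) (inverseˡ (transpose x z)))
      (trans (cong (transpose x z ⟨$⟩ʳ_) (involutive isN _)) (inverseʳ (transpose x z)))
    by-cases : (P : Fin n → Set) → P x → P y → P z →
      (∀ i → i ≢ x → i ≢ y → i ≢ z → P i) → ∀ i → P i
    by-cases P px py pz pi i with i ≟ x | i ≟ y | i ≟ z
    ... | yes refl | _ | _ = px
    ... | no _ | yes refl | _ = py
    ... | no _ | no _ | yes refl = pz
    ... | no i≢x | no i≢y | no i≢z = pi i i≢x i≢y i≢z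
    non : ∀ i → adj G i (N′ i) ≡ false
    non = by-cases _
      (trans (cong (adj G x) N′x) Mxy)
      (trans (cong (adj G y) N′y) (trans (adj-sym G y x) Mxy))
      (trans (cong (adj G z) N′z) (irrefl G z))
      (λ i i≢x i≢y i≢z → trans (cong (adj G i) (N′i i≢x i≢y i≢z)) (nonadjacent isN i))
    -- At `x` and `y`, `M` agrees with `N′`. At `z` it already disagrees with `N`, since `M z ≡ y`
    -- would make `z` the partner `x` of `y`. Elsewhere `N′` is `N`.
    agree : ∀ i → M i ≢ N′ i → M i ≢ N i
    agree = by-cases _
      (λ p _ → p (sym N′x))
      (λ p _ → p (trans My (sym N′y)))
      (λ _ q → z≢x (trans (sym (flip isM (trans q Nz))) My))
      (λ i i≢x i≢y i≢z p q → p (trans q (sym (N′i i≢x i≢y i≢z))))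

  -- For a maximum matching M missing u and v, a maximum matching missing w could
  -- be exchanged forever for one closer to M.
  ¬missedTogether-trans : ∀ {u v w} → MissedTogether w w →
    ¬ MissedTogether u w → ¬ MissedTogether v w → u ≢ v → ¬ MissedTogether u v
  ¬missedTogether-trans {u} {v} {w} (N , isN , N≤d , Nw , _) ¬uw ¬vw u≢v (M , isM , M≤d , Mu , Mv) =
    descend N isN N≤d Nw (<-wellFounded _)
    where
    descend : ∀ N → Matching G N → fixes N ℕ.≤ d → N w ≡ w →
      Acc ℕ._<_ (count (disagree? M N)) → ⊥
    descend N isN N≤d Nw (acc rec)
      with N′ , isN′ , N′≤d , N′w , closer ← exchange ¬uw ¬vw u≢v isM M≤d Mu Mv isN N≤d Nw =
      descend N′ isN′ N′≤d N′w (rec closer)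

  -- Being equal or not missed together is transitive by `¬missedTogether-trans`, and vertices in
  -- different classes are missed together, hence adjacent. If `u` and `v` were missed together, the
  -- class of `u` would omit `v` and separate `G`.
  gallai : Nonseparable G → (∀ v → MissedTogether v v) → ∀ {u v} → u ≢ v → ¬ MissedTogether u v
  gallai nonsep missed {u} {v} u≢v uv = nonsep (does ∘ inside? ,
      (u , dec-true (inside? u) (inj₁ refl)) ,
      (v , dec-false (inside? v) λ { (inj₁ v≡u) → u≢v (sym v≡u) ; (inj₂ ¬uv) → ¬uv uv }) ,
      cross)
    where
    Inside : Fin n → Set
    Inside i = i ≡ u ⊎ ¬ MissedTogether u i
    inside? : Decidable Inside
    inside? i = (i ≟ u) ⊎-dec ¬? (missedTogether? u i)
    swap : ∀ {i j} → MissedTogether i j → MissedTogether j i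
    swap (σ , M , le , σi , σj) = σ , M , le , σj , σi
    cross : ∀ i j → does (inside? i) ≡ true → does (inside? j) ≡ false → adj G i j ≡ true
    cross i j i∈ j∉ =
      separated (does-true (inside? i) i∈) (does-false (inside? j) j∉) (missedTogether? j i)
      where
      separated : Inside i → ¬ Inside j → Dec (MissedTogether j i) → adj G i j ≡ true
      separated i∈ j∉ (yes ji) = missedTogether⇒adjacent (λ { refl → j∉ i∈ }) (swap ji)
      separated (inj₁ refl) j∉ (no ¬ji) = contradiction (inj₂ (¬ji ∘ swap)) j∉
      separated (inj₂ ¬ui) j∉ (no ¬ji) = contradiction
        (inj₂ (¬missedTogether-trans (missed i) ¬ui ¬ji (λ { refl → j∉ (inj₁ refl) }))) j∉

-- Colourings and matchings

enumerate : {P : Fin n → Set} (P? : Decidable P) →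
  ∃ λ (e : Fin (count P?) → Fin n) → (∀ a → P (e a)) × Injective _≡_ _≡_ e
enumerate {zero} P? = (λ ()) , (λ ()) , λ { {()} }
enumerate {suc n} P? with P? zero | enumerate (P? ∘ suc)
... | no _  | e , pe , inj = suc ∘ e , pe , inj ∘ suc-injective
... | yes p | e , pe , inj =
  zero ◂ (suc ∘ e) , (λ { zero → p ; (suc a) → pe a }) ,
  λ { {zero}  {zero}  _ → refl
    ; {suc a} {suc b} q → cong suc (inj (suc-injective q)) }

index : {P : Fin n → Set} (P? : Decidable P) →
  ∃ λ (ix : ∃ P → Fin (count P?)) → ∀ p q → ix p ≡ ix q → proj₁ p ≡ proj₁ q
index {zero} P? = (λ { (() , _) }) , λ { (() , _) }
index {suc n} P? with P? zero | index (P? ∘ suc)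
... | no ¬p | ix , inj =
  (λ { (zero , p) → contradiction p ¬p ; (suc i , p) → ix (i , p) }) , λ where
    (zero , p)  _           _ → contradiction p ¬p
    (suc _ , _) (zero , p)  _ → contradiction p ¬p
    (suc i , p) (suc j , q) r → cong suc (inj (i , p) (j , q) r)
... | yes _ | ix , inj =
  (λ { (zero , _) → zero ; (suc i , p) → suc (ix (i , p)) }) , λ where
    (zero , _)  (zero , _)  _ → refl
    (suc i , p) (suc j , q) r → cong suc (inj (i , p) (j , q) (suc-injective r))

count-unique : {P : Fin n → Set} (P? : Decidable P) → ∀ j → P j → (∀ i → P i → i ≡ j) →
  count P? ≡ 1
count-unique P? j pj unique with enumerate P? | index P?
... | e , pe , e-inj | ix , _ = ℕₚ.≤-antisym
  (injective⇒≤ {n = 1} {f = λ _ → zero}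
    λ {a} {b} _ → e-inj (trans (unique _ (pe a)) (sym (unique _ (pe b)))))
  (injective⇒≤ {m = 1} {f = λ _ → ix (j , pj)} λ { {zero} {zero} _ → refl })

sum-ones : ∀ n → sum {n} (λ _ → 1) ≡ n
sum-ones zero    = refl
sum-ones (suc n) = cong suc (sum-ones n)

first? : (σ : Fin n → Fin n) → Decidable λ i → i Fin.≤ σ i
first? σ i = i Fin.≤? σ i

-- Every orbit of an involution has exactly one `i` with `i ≤ σ i`, so this counts orbits, fixed
-- points included.
pairs : (Fin n → Fin n) → ℕ
pairs σ = count (first? σ)

-- Reindexing by `σ` turns `i ≤ σ i` into `σ i ≤ i`, so both conditions have the same count. Each
-- `i` satisfies at least one of them, and both exactly when it is fixed.
pairs+pairs : {σ : Fin n → Fin n} → (∀ i → σ (σ i) ≡ i) → pairs σ ℕ.+ pairs σ ≡ n ℕ.+ fixes σ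
pairs+pairs {n} {σ} inv = begin
  pairs σ ℕ.+ pairs σ                              ≡⟨ cong (pairs σ ℕ.+_) first≡last ⟩
  pairs σ ℕ.+ count last?                          ≡⟨ ∑-distrib-+ (λ i → 𝟙 (first? σ i)) (λ i → 𝟙 (last? i)) ⟨
  sum (λ i → 𝟙 (first? σ i) ℕ.+ 𝟙 (last? i))     ≡⟨ sum-cong-≗ (λ i → one (first? σ i) (last? i) (fixed? σ i)) ⟩
  sum (λ i → 1 ℕ.+ 𝟙 (fixed? σ i))                ≡⟨ ∑-distrib-+ (λ _ → 1) (λ i → 𝟙 (fixed? σ i)) ⟩
  sum {n} (λ _ → 1) ℕ.+ fixes σ                    ≡⟨ cong (ℕ._+ fixes σ) (sum-ones n) ⟩
  n ℕ.+ fixes σ                                    ∎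
  where
  open ≡-Reasoning
  last? : Decidable λ i → σ i Fin.≤ i
  last? i = σ i Fin.≤? i
  first≡last : pairs σ ≡ count last?
  first≡last = trans (sum-permute _ (permutation σ σ inv inv)) (ℕₚ.≤-antisym
    (count-mono (first? σ ∘ σ) last? λ i → subst (σ i Fin.≤_) (inv i))
    (count-mono last? (first? σ ∘ σ) λ i → subst (σ i Fin.≤_) (sym (inv i))))
  one : ∀ {i} (a? : Dec (i Fin.≤ σ i)) (b? : Dec (σ i Fin.≤ i)) (c? : Dec (σ i ≡ i)) →
    𝟙 a? ℕ.+ 𝟙 b? ≡ 1 ℕ.+ 𝟙 c?
  one (yes _) (yes _) (yes _) = refl
  one (yes a) (yes b) (no ¬c) = contradiction (Finₚ.≤-antisym b a) ¬c
  one (no ¬a) _       (yes c) = contradiction (Finₚ.≤-reflexive (sym c)) ¬a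
  one (yes _) (no ¬b) (yes c) = contradiction (Finₚ.≤-reflexive c) ¬b
  one (yes _) (no _)  (no _)  = refl
  one (no _)  (yes _) (no _)  = refl
  one (no ¬a) (no ¬b) _       = contradiction (ℕₚ.≰⇒≥ ¬a) ¬b

Proper : Graph n → (Fin n → Fin k) → Set
Proper G col = ∀ i j → adj G i j ≡ true → col i ≢ col j

-- The orbits are the colour classes, each named by its `root`, the smaller end. Vertices with the
-- same root are equal or matched, hence nonadjacent.
matching⇒colorable : (G : Graph n) {σ : Fin n → Fin n} → Matching G σ → Colorable G (pairs σ)
matching⇒colorable G {σ} M with index (first? σ)
... | ix , ix-inj = color , proper
  where
  root : ∀ i → Dec (i Fin.≤ σ i) → ∃ λ r → r Fin.≤ σ r
  root i (yes p) = i , p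
  root i (no ¬p) = σ i , subst (σ i Fin.≤_) (sym (involutive M i)) (ℕₚ.≰⇒≥ ¬p)
  root-image : ∀ i d → proj₁ (root i d) ≡ i ⊎ proj₁ (root i d) ≡ σ i
  root-image i (yes _) = inj₁ refl
  root-image i (no _)  = inj₂ refl
  color : Fin _ → Fin (pairs σ)
  color i = ix (root i (first? σ i))
  proper : Proper G color
  proper i j ij ci≡cj = contradiction (trans (sym ij) nonadj) λ ()
    where
    same : proj₁ (root i (first? σ i)) ≡ proj₁ (root j (first? σ j))
    same = ix-inj _ _ ci≡cj
    nonadj : adj G i j ≡ false
    nonadj with root-image i (first? σ i) | root-image j (first? σ j)
    ... | inj₁ p | inj₁ q =
      trans (cong (adj G i) (trans (sym q) (trans (sym same) p))) (irrefl G i)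
    ... | inj₁ p | inj₂ q =
      trans (cong (adj G i) (sym (flip M (trans (sym q) (trans (sym same) p)))))
            (nonadjacent M i)
    ... | inj₂ p | inj₁ q =
      trans (cong (adj G i) (trans (sym q) (trans (sym same) p))) (nonadjacent M i)
    ... | inj₂ p | inj₂ q =
      trans (cong (λ l → adj G l j)
              (trans (sym (flip M (trans (sym p) (trans same q)))) (involutive M j)))
            (irrefl G j)

monochromatic⇒nonadjacent : (G : Graph n) {col : Fin n → Fin k} → Proper G col →
  ∀ {i j} → col i ≡ col j → adj G i j ≡ false
monochromatic⇒nonadjacent G proper ci≡cj = ¬-not λ ij → proper _ _ ij ci≡cj

module _ (G : Graph n) (α<3 : ¬ HasIndep G 3) {col : Fin n → Fin k} (proper : Proper G col) where

  no-triple : ∀ {i j l} → i ≢ j → i ≢ l → j ≢ l → col i ≡ col j → col i ≡ col l → ⊥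
  no-triple {i} {j} {l} i≢j i≢l j≢l cij cil = α<3 (v , distinct , λ a b →
    monochromatic⇒nonadjacent G proper (trans (same a) (sym (same b))))
    where
    v : Fin 3 → Fin n
    v = i ◂ j ◂ l ◂ λ ()
    same : ∀ a → col (v a) ≡ col i
    same zero = refl
    same (suc zero) = sym cij
    same (suc (suc zero)) = sym cil
    distinct : ∀ a b → a ≢ b → v a ≢ v b
    distinct zero zero a≢b = contradiction refl a≢b
    distinct zero (suc zero) _ = i≢j
    distinct zero (suc (suc zero)) _ = i≢l
    distinct (suc zero) zero _ = i≢j ∘ sym
    distinct (suc zero) (suc zero) a≢b = contradiction refl a≢b
    distinct (suc zero) (suc (suc zero)) _ = j≢l
    distinct (suc (suc zero)) zero _ = i≢l ∘ sym
    distinct (suc (suc zero)) (suc zero) _ = j≢l ∘ sym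
    distinct (suc (suc zero)) (suc (suc zero)) a≢b = contradiction refl a≢b

  -- As α ≤ 2, a colour class has at most two vertices, and `σ` exchanges them. Distinct orbits have
  -- distinct colours, so `pairs σ ≤ k`, and doubling gives the bound.
  colorMatching : ∃ λ σ → Matching G σ × (∀ i → col (σ i) ≡ col i) × (n ℕ.+ fixes σ ℕ.≤ k ℕ.+ k)
  colorMatching = σ , record
      { involutive = inv
      ; nonadjacent = λ i → monochromatic⇒nonadjacent G proper (sym (col-σ i)) } ,
    col-σ , subst (ℕ._≤ k ℕ.+ k) (pairs+pairs inv) (ℕₚ.+-mono-≤ pairs≤k pairs≤k)
    where
    partner? : ∀ i → Dec (∃ λ j → j ≢ i × col j ≡ col i)
    partner? i = any? λ j → ¬? (j ≟ i) ×-dec (col j ≟ col i)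
    σ : Fin n → Fin n
    σ i with partner? i
    ... | yes (j , _) = j
    ... | no _        = i
    col-σ : ∀ i → col (σ i) ≡ col i
    col-σ i with partner? i
    ... | yes (_ , _ , cj≡ci) = cj≡ci
    ... | no _                = refl
    class : ∀ i j → col j ≡ col i → j ≡ i ⊎ j ≡ σ i
    class i j cj≡ci with j ≟ i | partner? i
    ... | yes j≡i | _ = inj₁ j≡i
    ... | no j≢i  | no none = contradiction (j , j≢i , cj≡ci) none
    ... | no j≢i  | yes (l , l≢i , cl≡ci) with j ≟ l
    ...   | yes j≡l = inj₂ j≡l
    ...   | no j≢l  = ⊥-elim (no-triple (j≢i ∘ sym) (l≢i ∘ sym) j≢l (sym cj≡ci) (sym cl≡ci))
    inv : ∀ i → σ (σ i) ≡ i
    inv i with class (σ i) i (sym (col-σ i))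
    ... | inj₁ i≡σi  = trans (cong σ (sym i≡σi)) (sym i≡σi)
    ... | inj₂ i≡σσi = sym i≡σσi
    pairs≤k : pairs σ ℕ.≤ k
    pairs≤k with enumerate (first? σ)
    ... | e , first , e-inj = injective⇒≤ {f = col ∘ e} λ {a} {b} ca≡cb → e-inj (equal a b ca≡cb)
      where
      equal : ∀ a b → col (e a) ≡ col (e b) → e a ≡ e b
      equal a b ca≡cb with class (e b) (e a) ca≡cb
      ... | inj₁ ea≡eb  = ea≡eb
      ... | inj₂ ea≡σeb = Finₚ.≤-antisym
        (subst (e a Fin.≤_) (trans (cong σ ea≡σeb) (inv (e b))) (first a))
        (subst (e b Fin.≤_) (sym ea≡σeb) (first b))

-- Chromatic and clique numbers

pullback : Graph n → (Fin m → Fin n) → Graph m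
pullback G e = record
  { adj    = λ i j → adj G (e i) (e j)
  ; sym    = λ i j → adj-sym G (e i) (e j)
  ; irrefl = λ i → irrefl G (e i) }

adjacent⇒distinct : (G : Graph n) → ∀ {i j} → adj G i j ≡ true → i ≢ j
adjacent⇒distinct G {i} ij refl = contradiction (trans (sym ij) (irrefl G i)) λ ()

colorable-order : (G : Graph n) → Colorable G n
colorable-order G = id , λ i j → adjacent⇒distinct G

clique≤colors : (G : Graph n) → ∀ {j} → HasClique G j → Colorable G k → j ℕ.≤ k
clique≤colors G (v , clique) (col , proper) = injective⇒≤ {f = col ∘ v} λ {a} {b} ca≡cb →
  decidable-stable (a ≟ b) λ a≢b → proper _ _ (clique a b a≢b) ca≡cb

colorable? : (G : Graph n) → Decidable (Colorable G)
colorable? G k = any-function? (Proper G)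
  (λ f≗g proper i j ij gi≡gj → proper i j ij (trans (f≗g i) (trans gi≡gj (sym (f≗g j)))))
  (λ f → all? λ i → all? λ j → (adj G i j Bool.≟ true) →-dec ¬? (f i ≟ f j))

hasClique? : (G : Graph n) → Decidable (HasClique G)
hasClique? G k = any-function? _
  (λ f≗g clique a b a≢b → trans (sym (cong₂ (adj G) (f≗g a) (f≗g b))) (clique a b a≢b))
  (λ v → all? λ a → all? λ b → ¬? (a ≟ b) →-dec (adj G (v a) (v b) Bool.≟ true))

χ : (G : Graph n) → ∃ (IsChi G)
χ {n} G = least (colorable? G) n (colorable-order G)

ω : (G : Graph n) → ∃ (IsOmega G)
ω {n} G = greatest (hasClique? G) n ((λ ()) , λ ())
  λ j K → clique≤colors G K (colorable-order G)

ω-pullback : (G : Graph n) (e : Fin m → Fin n) → ∀ {w wₑ} →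
  IsOmega G w → IsOmega (pullback G e) wₑ → wₑ ℕ.≤ w
ω-pullback G e (_ , max) ((v , clique) , _) = max _ (e ∘ v , clique)

complement : (v : Fin k → Fin n) → (∀ a b → a ≢ b → v a ≢ v b) →
  ∃ λ m → ∃ λ (e : Fin m → Fin n) → m ℕ.+ k ≡ n × (∀ i → (∀ a → v a ≢ i) → ∃ λ j → e j ≡ i)
complement {zero} {n} v _ = n , id , ℕₚ.+-identityʳ n , λ i _ → i , refl
complement {suc k} {zero} v _ = contradiction (v zero) λ ()
complement {suc k} {suc n} v distinct =
  let m , e , m+k≡n , covers = complement (λ a → punchOut (v₀≢ a))
        (λ a b a≢b → distinct (suc a) (suc b) (a≢b ∘ suc-injective) ∘
                     punchOut-injective (v₀≢ a) (v₀≢ b))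
  in m , punchIn (v zero) ∘ e , trans (ℕₚ.+-suc m k) (cong suc m+k≡n) , λ i i∉v →
    let j , ej≡i = covers (punchOut (i∉v zero))
                     (λ a → i∉v (suc a) ∘ punchOut-injective (v₀≢ a) (i∉v zero))
    in j , trans (cong (punchIn (v zero)) ej≡i) (punchIn-punchOut (i∉v zero))
  where
  v₀≢ : ∀ a → v zero ≢ v (suc a)
  v₀≢ a = distinct zero (suc a) λ ()

-- The independent set gets the new colour `zero`, which no other vertex receives. The last
-- component records this; for a single vertex it leaves that vertex unmatched in `colorMatching`.
extendColoring : (G : Graph n) (v : Fin m → Fin n) → (∀ a b → adj G (v a) (v b) ≡ false) →
  ∀ {l} (e : Fin l → Fin n) → (∀ i → (∀ a → v a ≢ i) → ∃ λ j → e j ≡ i) →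
  Colorable (pullback G e) k → ∃ λ (col : Fin n → Fin (suc k)) → Proper G col ×
    (∀ i j → (∃ λ a → v a ≡ i) → col i ≡ col j → ∃ λ a → v a ≡ j)
extendColoring {n} {k = k} G v indep e covers (col , proper) =
  (λ i → color i (v? i)) , (λ i j ij → proper′ i j (v? i) (v? j) ij) ,
  λ i j i∈v → class i j i∈v (v? i) (v? j)
  where
  v? : ∀ i → Dec (∃ λ a → v a ≡ i)
  v? i = any? λ a → v a ≟ i
  color : ∀ i → Dec (∃ λ a → v a ≡ i) → Fin (suc k)
  color i (yes _)   = zero
  color i (no none) = suc (col (proj₁ (covers i λ a p → none (a , p))))
  proper′ : ∀ i j i? j? → adj G i j ≡ true → color i i? ≢ color j j?
  proper′ i j (yes (a , refl)) (yes (b , refl)) ij _ =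
    contradiction (trans (sym ij) (indep a b)) λ ()
  proper′ i j (no i∉) (no j∉) ij ci≡cj
    with covers i (λ a p → i∉ (a , p)) | covers j (λ a p → j∉ (a , p))
  ... | a , refl | b , refl = proper a b ij (suc-injective ci≡cj)
  class : ∀ i j → (∃ λ a → v a ≡ i) → ∀ i? j? → color i i? ≡ color j j? → ∃ λ a → v a ≡ j
  class i j i∈ (no i∉) _ _ = contradiction i∈ i∉
  class i j _ (yes _) (yes j∈) _ = j∈

χ-delete-zero : (G : Graph (suc n)) → ∀ {c c′} →
  IsChi G c → IsChi (pullback G suc) c′ → c ℕ.≤ suc c′
χ-delete-zero G (_ , min) (colorable , _) =
  let col , proper , _ = extendColoring {m = 1} G (λ _ → zero) (λ _ _ → irrefl G zero) suc
        (λ { zero ∉ → contradiction refl (∉ zero) ; (suc i) _ → i , refl }) colorable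
  in min _ (col , proper)

-- Minimal graphs

-- This and `linear-≤` take a certificate: `a ≤ b` is a sum of known inequalities, `d` is the slack,
-- and the equation is left to the ring solver.
linear-absurd : ∀ {a b} d → a ℕ.≤ b → a ≡ suc (b ℕ.+ d) → ⊥
linear-absurd {b = b} d a≤b refl = ℕₚ.<⇒≱ (s≤s (ℕₚ.m≤m+n b d)) a≤b

linear-≤ : ∀ {a b p q} d → a ℕ.≤ b → a ℕ.+ q ≡ b ℕ.+ p ℕ.+ d → p ℕ.≤ q
linear-≤ {a} {b} {p} {q} d a≤b eq = ℕₚ.+-cancelˡ-≤ a p q (begin
  a ℕ.+ p          ≤⟨ ℕₚ.+-monoˡ-≤ p a≤b ⟩
  b ℕ.+ p          ≤⟨ ℕₚ.m≤m+n (b ℕ.+ p) d ⟩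
  b ℕ.+ p ℕ.+ d    ≡⟨ eq ⟨
  a ℕ.+ q          ∎)
  where open ℕₚ.≤-Reasoning

-- `large` is |V| < χ + 2f - x with all subtractions moved across. In `minimal`, the bound `y` is
-- replaced by the requirement that χ - ω not exceed that of `G`.
module Minimal (G : Graph n) (c w x : ℕ) (isχ : IsChi G c) (isω : IsOmega G w)
  (large : n ℕ.+ (w ℕ.+ w) ℕ.+ x ℕ.< c ℕ.+ c ℕ.+ c)
  (minimal : ∀ {m} (H : Graph m) cₕ wₕ → IsChi H cₕ → IsOmega H wₕ →
    cₕ ℕ.+ w ℕ.≤ c ℕ.+ wₕ → m ℕ.+ (wₕ ℕ.+ wₕ) ℕ.+ x ℕ.< cₕ ℕ.+ cₕ ℕ.+ cₕ → n ℕ.≤ m)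
  where

  infixl 6 _⊕_
  _⊕_ : ∀ {a b a′ b′} → a ℕ.≤ b → a′ ℕ.≤ b′ → a ℕ.+ a′ ℕ.≤ b ℕ.+ b′
  _⊕_ = ℕₚ.+-mono-≤

  -- Deleting a vertex lowers χ − ω by at most 1 and does not increase |V| − χ, so
  -- a smaller H with χ − ω at least that of G would have a subgraph with equality,
  -- which lies in M(x, y).
  ¬smaller : ∀ m (H : Graph m) cₕ wₕ → IsChi H cₕ → IsOmega H wₕ →
    m ℕ.< n → m ℕ.+ c ℕ.≤ n ℕ.+ cₕ → ¬ (c ℕ.+ wₕ ℕ.≤ cₕ ℕ.+ w)
  ¬smaller m H cₕ wₕ χₕ ωₕ m<n excess f≤fₕ with cₕ ℕ.+ w ℕ.≤? c ℕ.+ wₕ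
  ... | yes fₕ≤f = ℕₚ.<⇒≱ m<n (minimal H cₕ wₕ χₕ ωₕ fₕ≤f (linear-≤ 0
    (excess ⊕ large ⊕ f≤fₕ ⊕ f≤fₕ) (solve (m ∷ n ∷ c ∷ w ∷ x ∷ cₕ ∷ wₕ ∷ []))))
  -- The empty graph has χ = 0, so its χ - ω cannot exceed that of `G`, which is nonnegative.
  ¬smaller zero H cₕ wₕ (_ , min) ωₕ m<n excess f≤fₕ | no fₕ≰f =
    linear-absurd wₕ
      (ℕₚ.≰⇒> fₕ≰f ⊕ clique≤colors G (proj₁ isω) (proj₁ isχ) ⊕ min 0 (id , λ ()))
      (solve (c ∷ w ∷ cₕ ∷ wₕ ∷ []))
  ¬smaller (suc m) H cₕ wₕ χₕ ωₕ m<n excess f≤fₕ | no fₕ≰f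
    with c′ , χ′ ← χ (pullback H suc) | w′ , ω′ ← ω (pullback H suc) =
    ¬smaller m (pullback H suc) c′ w′ χ′ ω′ (ℕₚ.<-trans (ℕₚ.n<1+n m) m<n)
      (linear-≤ 0 (excess ⊕ χ-delete-zero H χₕ χ′) (solve (m ∷ n ∷ c ∷ c′ ∷ cₕ ∷ [])))
      (linear-≤ 0
        (ℕₚ.≰⇒> fₕ≰f ⊕ χ-delete-zero H χₕ χ′ ⊕ ω-pullback H suc ωₕ ω′)
        (solve (c ∷ w ∷ c′ ∷ w′ ∷ cₕ ∷ wₕ ∷ [])))

  -- Let H be `G` without the image S of `v`. As S is nonempty and χ drops by at most 1, `¬smaller`
  -- gives f(H) < f(G). With ω(H) ≤ ω(G) this forces χ(H) = χ(G) - 1, so the extended colouring has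
  -- exactly `c` colours. The final inequality says that H, being smaller than `G`, lies outside
  -- M(x, y).
  deleteIndependent : ∀ {s} (v : Fin (suc s) → Fin n) → (∀ a b → a ≢ b → v a ≢ v b) →
    (∀ a b → adj G (v a) (v b) ≡ false) →
    (∃ λ (col : Fin n → Fin c) → Proper G col ×
      (∀ i j → (∃ λ a → v a ≡ i) → col i ≡ col j → ∃ λ a → v a ≡ j)) ×
    c ℕ.+ c ℕ.+ c ℕ.+ suc s ℕ.≤ n ℕ.+ (w ℕ.+ w) ℕ.+ x ℕ.+ 3
  deleteIndependent {s} v distinct indep
    with m , e , m+s≡n , covers ← complement v distinct
    with cₕ , χₕ ← χ (pullback G e) | wₕ , ωₕ ← ω (pullback G e) =
    subst (λ k → ∃ λ (col : Fin n → Fin k) → Proper G col ×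
      (∀ i j → (∃ λ a → v a ≡ i) → col i ≡ col j → ∃ λ a → v a ≡ j)) (sym c≡1+cₕ) ext ,
    linear-≤ 0
      (small ⊕ wₕ≤w ⊕ wₕ≤w ⊕ c≤1+cₕ ⊕ c≤1+cₕ ⊕ c≤1+cₕ ⊕ order≤)
      (solve (m ∷ n ∷ s ∷ c ∷ w ∷ x ∷ cₕ ∷ wₕ ∷ []))
    where
    ext = extendColoring G v indep e covers (proj₁ χₕ)
    order≤ : m ℕ.+ suc s ℕ.≤ n
    order≤ = ℕₚ.≤-reflexive m+s≡n
    m<n : m ℕ.< n
    m<n = ℕₚ.<-≤-trans (ℕₚ.m<m+n m (s≤s z≤n)) order≤
    c≤1+cₕ : c ℕ.≤ suc cₕ
    c≤1+cₕ = proj₂ isχ _ (proj₁ ext , proj₁ (proj₂ ext))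
    wₕ≤w : wₕ ℕ.≤ w
    wₕ≤w = ω-pullback G e isω ωₕ
    fₕ<f : cₕ ℕ.+ w ℕ.< c ℕ.+ wₕ
    fₕ<f = ℕₚ.≰⇒> (¬smaller m (pullback G e) cₕ wₕ χₕ ωₕ m<n
      (linear-≤ s (order≤ ⊕ c≤1+cₕ) (solve (m ∷ n ∷ s ∷ c ∷ cₕ ∷ []))))
    c≡1+cₕ : c ≡ suc cₕ
    c≡1+cₕ = ℕₚ.≤-antisym c≤1+cₕ
      (linear-≤ 0 (fₕ<f ⊕ wₕ≤w) (solve (c ∷ w ∷ cₕ ∷ wₕ ∷ [])))
    small : cₕ ℕ.+ cₕ ℕ.+ cₕ ℕ.≤ m ℕ.+ (wₕ ℕ.+ wₕ) ℕ.+ x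
    small = ℕₚ.≮⇒≥ λ lt → ℕₚ.<⇒≱ m<n
      (minimal (pullback G e) cₕ wₕ χₕ ωₕ (ℕₚ.<⇒≤ fₕ<f) lt)

  -- For |S| = 3 the bound reads |V| ≥ χ + 2f - x, against `large`.
  ¬independent₃ : ¬ HasIndep G 3
  ¬independent₃ (v , distinct , indep) =
    linear-absurd 0 (proj₂ (deleteIndependent v distinct indep) ⊕ large)
      (solve (n ∷ c ∷ w ∷ x ∷ []))

  independent₂ : HasIndep G 2
  independent₂ with any? (λ i → any? λ j → ¬? (i ≟ j) ×-dec (adj G i j Bool.≟ false))
  ... | yes (i , j , i≢j , ij) = i ◂ j ◂ (λ ()) , distinct , indep
    where
    distinct : ∀ a b → a ≢ b → (i ◂ j ◂ (λ ())) a ≢ (i ◂ j ◂ (λ ())) b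
    distinct zero       zero       a≢b = contradiction refl a≢b
    distinct zero       (suc zero) _   = i≢j
    distinct (suc zero) zero       _   = i≢j ∘ sym
    distinct (suc zero) (suc zero) a≢b = contradiction refl a≢b
    indep : ∀ a b → adj G ((i ◂ j ◂ (λ ())) a) ((i ◂ j ◂ (λ ())) b) ≡ false
    indep zero       zero       = irrefl G i
    indep zero       (suc zero) = ij
    indep (suc zero) zero       = trans (adj-sym G j i) ij
    indep (suc zero) (suc zero) = irrefl G j
  -- Then `G` is complete, so χ ≤ |V| ≤ ω and `large` fails, with slack `x`.
  ... | no none = ⊥-elim (linear-absurd x (large ⊕ n≤w ⊕ n≤w ⊕ c≤n ⊕ c≤n ⊕ c≤n)
      (solve (n ∷ c ∷ w ∷ x ∷ [])))
    where
    n≤w : n ℕ.≤ w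
    n≤w = proj₂ isω n (id , λ i j i≢j → ¬-not λ ij → none (i , j , i≢j , ij))
    c≤n : c ℕ.≤ n
    c≤n = proj₂ isχ n (colorable-order G)

  isAlpha : IsAlpha G 2
  isAlpha = independent₂ , λ k (v , distinct , indep) → ℕₚ.≮⇒≥ λ 2<k → ¬independent₃
    (v ∘ (λ a → inject≤ a 2<k) ,
     (λ a b a≢b → distinct _ _ (a≢b ∘ inject≤-injective 2<k 2<k a b)) ,
     λ a b → indep _ _)

  -- One direction is `large`, the other the deletion bound for |S| = 2.
  threeχ : n ℕ.+ (w ℕ.+ w) ℕ.+ x ℕ.+ 1 ≡ c ℕ.+ c ℕ.+ c
  threeχ = ℕₚ.≤-antisym (subst (ℕ._≤ c ℕ.+ c ℕ.+ c) (ℕₚ.+-comm 1 _) large)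
    (linear-≤ 0 pair-bound (solve (n ∷ c ∷ w ∷ x ∷ [])))
    where
    pair-bound : c ℕ.+ c ℕ.+ c ℕ.+ 2 ℕ.≤ n ℕ.+ (w ℕ.+ w) ℕ.+ x ℕ.+ 3
    pair-bound = let v , distinct , indep = independent₂
                 in proj₂ (deleteIndependent v distinct indep)

  -- Deleting `v` alone gives an optimal colouring with `v` as a class of its own, so the induced
  -- matching misses `v`. With `fixes-lower`, the bound says that this matching is maximum.
  matchingMissing : ∀ v → ∃ λ σ → Matching G σ × n ℕ.+ fixes σ ℕ.≤ c ℕ.+ c × σ v ≡ v
  matchingMissing v =
    let (col , proper , class) , _ = deleteIndependent {0} (λ _ → v)
          (λ { zero zero a≢b → contradiction refl a≢b }) (λ _ _ → irrefl G v)
        σ , M , col-σ , bound = colorMatching G ¬independent₃ proper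
        _ , v≡σv = class v (σ v) (zero , refl) (sym (col-σ v))
    in σ , M , bound , sym v≡σv

  -- The orbits of `σ` colour `G`, so χ ≤ `pairs σ`; hence no matching misses fewer than 2χ - |V|
  -- vertices.
  fixes-lower : ∀ σ → Matching G σ → c ℕ.+ c ℕ.≤ n ℕ.+ fixes σ
  fixes-lower σ M = subst (c ℕ.+ c ℕ.≤_) (pairs+pairs (involutive M))
    (proj₂ isχ _ (matching⇒colorable G M) ⊕ proj₂ isχ _ (matching⇒colorable G M))

  -- A maximum matching misses 2χ - |V| vertices, and by `gallai` only one. `independent₂` supplies
  -- a vertex to start from.
  twoχ : Nonseparable G → n ℕ.+ 1 ≡ c ℕ.+ c
  twoχ nonsep =
    let v₀ = proj₁ independent₂ zero
        σ , M , bound , σv₀ = matchingMissing v₀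
    in trans (cong (n ℕ.+_) (sym (fixes≡1 M bound σv₀)))
             (ℕₚ.≤-antisym bound (fixes-lower σ M))
    where
    fixes≡1 : ∀ {σ v₀} → Matching G σ → n ℕ.+ fixes σ ℕ.≤ c ℕ.+ c → σ v₀ ≡ v₀ → fixes σ ≡ 1
    fixes≡1 {σ} {v₀} M bound σv₀ =
      count-unique (fixed? σ) v₀ σv₀ λ i σi → decidable-stable (i ≟ v₀) λ i≢v₀ →
        gallai G (fixes σ) maximum nonsep missed i≢v₀ (σ , M , ℕₚ.≤-refl , σi , σv₀)
      where
      maximum : ∀ τ → Matching G τ → fixes σ ℕ.≤ fixes τ
      maximum τ T = ℕₚ.+-cancelˡ-≤ n _ _ (ℕₚ.≤-trans bound (fixes-lower τ T))
      missed : ∀ v → MissedTogether G (fixes σ) maximum v v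
      missed v =
        let τ , T , τ-bound , τv = matchingMissing v
        in τ , T , ℕₚ.+-cancelˡ-≤ n _ _ (ℕₚ.≤-trans τ-bound (fixes-lower σ M)) , τv , τv

  -- Comparing `threeχ` with `twoχ` eliminates |V|. In terms of f the result says ω = f - x.
  χ-value : Nonseparable G → w ℕ.+ w ℕ.+ x ≡ c
  χ-value nonsep = ℕₚ.+-cancelʳ-≡ (c ℕ.+ c) _ _ (begin
    w ℕ.+ w ℕ.+ x ℕ.+ (c ℕ.+ c)   ≡⟨ cong (w ℕ.+ w ℕ.+ x ℕ.+_) (twoχ nonsep) ⟨
    w ℕ.+ w ℕ.+ x ℕ.+ (n ℕ.+ 1)   ≡⟨ solve (n ∷ w ∷ x ∷ []) ⟩
    n ℕ.+ (w ℕ.+ w) ℕ.+ x ℕ.+ 1   ≡⟨ threeχ ⟩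
    c ℕ.+ c ℕ.+ c                 ≡⟨ ℕₚ.+-assoc c c c ⟩
    c ℕ.+ (c ℕ.+ c)               ∎)
    where open ≡-Reasoning

-- Translation to the integers and conclusion

IsChi-unique : (G : Graph n) → ∀ {c c′} → IsChi G c → IsChi G c′ → c ≡ c′
IsChi-unique G (p , min) (p′ , min′) = ℕₚ.≤-antisym (min _ p′) (min′ _ p)

IsOmega-unique : (G : Graph n) → ∀ {w w′} → IsOmega G w → IsOmega G w′ → w ≡ w′
IsOmega-unique G (p , max) (p′ , max′) = ℕₚ.≤-antisym (max′ _ p) (max _ p′)

large⇒ : ∀ n c w x → + n < + c + + 2 * (+ c - + w) - + x →
  n ℕ.+ (w ℕ.+ w) ℕ.+ x ℕ.< c ℕ.+ c ℕ.+ c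
large⇒ n c w x lt = ℤₚ.drop‿+<+ (subst₂ _<_ (left (+ n) (+ w) (+ x)) (right (+ c) (+ w) (+ x))
  (ℤₚ.+-monoˡ-< (+ w + + w + + x) lt))
  where
  left : ∀ n w x → n + (w + w + x) ≡ n + (w + w) + x
  left = ℤ-Solver.solve-∀
  right : ∀ c w x → c + + 2 * (c - w) - x + (w + w + x) ≡ c + c + c
  right = ℤ-Solver.solve-∀

large⇐ : ∀ n c w x → n ℕ.+ (w ℕ.+ w) ℕ.+ x ℕ.< c ℕ.+ c ℕ.+ c →
  + n < + c + + 2 * (+ c - + w) - + x
large⇐ n c w x lt = subst₂ _<_ (left (+ n) (+ w) (+ x)) (right (+ c) (+ w) (+ x))
  (ℤₚ.+-monoˡ-< (- (+ w + + w + + x)) (ℤ.+<+ lt))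
  where
  left : ∀ n w x → n + (w + w) + x + - (w + w + x) ≡ n
  left = ℤ-Solver.solve-∀
  right : ∀ c w x → c + c + c + - (w + w + x) ≡ c + + 2 * (c - w) - x
  right = ℤ-Solver.solve-∀

difference-≤ : ∀ a b c d → a ℕ.+ d ℕ.≤ c ℕ.+ b → + a - + b ≤ + c - + d
difference-≤ a b c d le = subst₂ _≤_ (left (+ a) (+ b) (+ d)) (right (+ b) (+ c) (+ d))
  (ℤₚ.+-monoˡ-≤ (- (+ b + + d)) (ℤ.+≤+ le))
  where
  left : ∀ a b d → a + d + - (b + d) ≡ a - b
  left = ℤ-Solver.solve-∀
  right : ∀ b c d → c + b + - (b + d) ≡ c - d
  right = ℤ-Solver.solve-∀

-- From χ = 2ω + x follows f = ω + x, which turns 2χ - 1 into 4f - 2x - 1.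
order-value : ∀ n {c} w x → w ℕ.+ w ℕ.+ x ≡ c → n ℕ.+ 1 ≡ c ℕ.+ c →
  + n ≡ + 4 * (+ c - + w) - + 2 * + x - + 1
order-value n {c} w x refl eq = begin
  + n                                          ≡⟨ shift (+ n) ⟩
  + n + + 1 - + 1                              ≡⟨ cong (λ k → + k - + 1) eq ⟩
  + (c ℕ.+ c) - + 1                            ≡⟨ value (+ w) (+ x) ⟩
  + 4 * (+ c - + w) - + 2 * + x - + 1          ∎
  where
  open ≡-Reasoning
  shift : ∀ n → n ≡ n + + 1 - + 1
  shift = ℤ-Solver.solve-∀
  value : ∀ w x → w + w + x + (w + w + x) - + 1 ≡ + 4 * (w + w + x - w) - + 2 * x - + 1
  value = ℤ-Solver.solve-∀

-- The Ramsey parameter f - x + 1 is one more than the clique number.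
clique-value : ∀ {c} w x → w ℕ.+ w ℕ.+ x ≡ c → + c - + w - + x + + 1 ≡ + suc w
clique-value w x refl = value (+ w) (+ x)
  where
  value : ∀ w x → w + w + x - w - x + + 1 ≡ + 1 + w
  value = ℤ-Solver.solve-∀

theorem3p1 : (x y : ℤ) → + 0 ≤ x → (n : ℕ) → (G₀ : Graph n) →
    IsMinimalIn x y G₀ → Nonseparable G₀ →
    (c w : ℕ) → IsChi G₀ c → IsOmega G₀ w →
    (+ n ≡ + 4 * (+ c - + w) - + 2 * x - + 1) ×
    ((r : ℕ) → IsR3 ((+ c - + w) - x + + 1) r →
    + 4 * (+ c - + w) - + 2 * x - + 1 < + r)
theorem3p1 (+ x) y _ n G ((c′ , w′ , χ′ , ω′ , large , f≤y) , min) nonsep c w isχ isω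
  with refl ← IsChi-unique G χ′ isχ | refl ← IsOmega-unique G ω′ isω =
  value , λ r (ramsey , _) → subst (_< + r) value
    -- If `r ≤ n`, the Ramsey property would apply to `G` itself, whose ω is below the parameter and
    -- whose α is 2.
    (ℤ.+<+ (ℕₚ.≰⇒> λ r≤n → ¬ramsey (ramsey n r≤n G w 2 isω isAlpha)))
  where
  minimal : ∀ {m} (H : Graph m) cₕ wₕ → IsChi H cₕ → IsOmega H wₕ →
    cₕ ℕ.+ w ℕ.≤ c ℕ.+ wₕ → m ℕ.+ (wₕ ℕ.+ wₕ) ℕ.+ x ℕ.< cₕ ℕ.+ cₕ ℕ.+ cₕ → n ℕ.≤ m
  minimal {m} H cₕ wₕ χₕ ωₕ fₕ≤f largeₕ = min m H
    (cₕ , wₕ , χₕ , ωₕ , large⇐ m cₕ wₕ x largeₕ ,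
     ℤₚ.≤-trans (difference-≤ cₕ wₕ c w fₕ≤f) f≤y)
  open Minimal G c w x isχ isω (large⇒ n c w x large) minimal
  value = order-value n w x (χ-value nonsep) (twoχ nonsep)
  ¬ramsey : ¬ ((+ c - + w) - + x + + 1 ≤ + w ⊎ 3 ℕ.≤ 2)
  ¬ramsey (inj₁ p≤w) = ℕₚ.<-irrefl refl
    (ℤₚ.drop‿+≤+ (subst (_≤ + w) (clique-value w x (χ-value nonsep)) p≤w))
  ¬ramsey (inj₂ (s≤s (s≤s ())))
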